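{- Let $D$ be a finite set and $P:D^2\to\{0,1\}$ a binary predicate. Assume there exist two-element subsets $B,C\subseteq D$ such that $P|_{B\times C}$ is a singleton. Then for every positive integer $n$ there is an instance $I$ of $\mathrm{CSP}(P)$ with $2n$ variables and $n^2$ constraints such that for every $0<\varepsilon<1$, every $\varepsilon$-sparsifier of $I$ has $n^2$ constraints.
   Context: A binary CSP instance is $I=(V,D,\Pi,w)$ where $V$ is a finite set of variables, $D$ a finite domain, $\Pi$ a set of constraints, each a pair $\langle (u,v),P\rangle$ with $u,v\in V$ distinct and $P:D^2\to\{0,1\}$, and $w:\Pi\to\mathbb{R}_{>0}$ positive weights. $\mathrm{CSP}(P)$ is the class of instances in which every constraint uses the predicate $P$. For an assignment $A:V\to D$, $\mathrm{Val}_I(A)=\sum_{\pi=\langle(u,v),P\rangle\in\Pi} w(\pi)P(A(u),A(v))$. For $0<\varepsilon<1$, an $\varepsilon$-sparsifier of $I$ is an instance $I_\varepsilon=(V,D,\Pi_\varepsilon,w_\varepsilon)$ with $\Pi_\varepsilon\subseteq\Pi$ and $w_\varepsilon:\Pi_\varepsilon\to\mathbb{R}_{>0}$ such that for every $A:V\to D$, $(1-\varepsilon)\mathrm{Val}_I(A)\le \mathrm{Val}_{I_\varepsilon}(A)\le(1+\varepsilon)\mathrm{Val}_I(A)$; its number of constraints is $|\Pi_\varepsilon|$. A predicate is a singleton if exactly one tuple is mapped to $1$. $P|_{B\times C}$ denotes the restriction of $P$ to $B\times C$. -}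

module Defs where

open import Data.Bool.Base using (Bool; true; false)
open import Data.Fin.Base using (Fin)
open import Data.Fin.Subset using (Subset; _∈_)
open import Data.Nat.Base as ℕ using (ℕ)
import Data.Nat.Properties as ℕ
open import Data.Product using (∃; ∃!; ∃-syntax; _×_; _,_; proj₁)
open import Data.Rational.Base as ℚ using (ℚ; 0ℚ; 1ℚ; ½; ∣_∣; Positive)
import Data.Rational.Properties as ℚ
open import Data.Vec.Functional using (foldr)
open import Function.Definitions using (Injective)
open import Relation.Binary.PropositionalEquality
open import Relation.Nullary.Negation.Core using (¬_)
open import Algebra.Bundles using (AbelianGroup)
open import Algebra.Properties.CommutativeSemigroup
  (AbelianGroup.commutativeSemigroup ℚ.+-0-abelianGroup) using (interchange)
open import Algebra.Properties.Group ℚ.+-0-group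
  using () renaming (//-rightDividesˡ to rightDividesˡ)
open import Algebra.Properties.Ring ℚ.+-*-ring
  using (x[y-z]≈xy-xz; [y-z]x≈yx-zx)

------------------------------------------------------------------------
-- Real numbers, as Cauchy sequences of rationals with a modulus.
-- Representatives are not quotiented: equality of reals is
-- x ≤ℝ y × y ≤ℝ x.

Cauchy : (ℕ → ℚ) → Set
Cauchy x = ∀ (δ : ℚ) → 0ℚ ℚ.< δ →
  ∃[ N ] ∀ m n → N ℕ.≤ m → N ℕ.≤ n → ∣ x m ℚ.- x n ∣ ℚ.≤ δ

record ℝ : Set where
  constructor mkℝ
  field
    seq    : ℕ → ℚ
    cauchy : Cauchy seq

open ℝ public

infix  4 _<ℝ_ _≤ℝ_
infixl 6 _+ℝ_ _-ℝ_
infixl 7 _*ℝ_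

_<ℝ_ : ℝ → ℝ → Set
x <ℝ y = ∃[ δ ] 0ℚ ℚ.< δ ×
  (∃[ N ] ∀ n → N ℕ.≤ n → seq x n ℚ.+ δ ℚ.≤ seq y n)

_≤ℝ_ : ℝ → ℝ → Set
x ≤ℝ y = ¬ (y <ℝ x)

abstract

  const-cauchy : ∀ q → Cauchy (λ _ → q)
  const-cauchy q δ 0<δ = 0 , λ _ _ _ _ →
    subst (λ r → ∣ r ∣ ℚ.≤ δ) (sym (ℚ.+-inverseʳ q)) (ℚ.<⇒≤ 0<δ)

  +-cauchy : ∀ x y → Cauchy x → Cauchy y → Cauchy (λ n → x n ℚ.+ y n)
  +-cauchy x y cx cy δ 0<δ
    with cx (½ ℚ.* δ) 0<½δ | cy (½ ℚ.* δ) 0<½δ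
    where
    0<½δ : 0ℚ ℚ.< ½ ℚ.* δ
    0<½δ = subst (ℚ._< ½ ℚ.* δ) (ℚ.*-zeroʳ ½) (ℚ.*-monoʳ-<-pos ½ 0<δ)
  ... | M , p | N , q = M ℕ.⊔ N , λ m n m≥ n≥ → begin
    ∣ (x m ℚ.+ y m) ℚ.- (x n ℚ.+ y n) ∣
      ≡⟨ cong ∣_∣ (rearrange (x m) (y m) (x n) (y n)) ⟩
    ∣ (x m ℚ.- x n) ℚ.+ (y m ℚ.- y n) ∣
      ≤⟨ ℚ.∣p+q∣≤∣p∣+∣q∣ (x m ℚ.- x n) (y m ℚ.- y n) ⟩
    ∣ x m ℚ.- x n ∣ ℚ.+ ∣ y m ℚ.- y n ∣
      ≤⟨ ℚ.+-mono-≤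
           (p m n (ℕ.≤-trans (ℕ.m≤m⊔n M N) m≥) (ℕ.≤-trans (ℕ.m≤m⊔n M N) n≥))
           (q m n (ℕ.≤-trans (ℕ.m≤n⊔m M N) m≥) (ℕ.≤-trans (ℕ.m≤n⊔m M N) n≥)) ⟩
    ½ ℚ.* δ ℚ.+ ½ ℚ.* δ
      ≡⟨ ℚ.*-distribʳ-+ δ ½ ½ ⟨
    1ℚ ℚ.* δ
      ≡⟨ ℚ.*-identityˡ δ ⟩
    δ ∎
    where
    open ℚ.≤-Reasoning
    rearrange : ∀ a b c d →
      (a ℚ.+ b) ℚ.- (c ℚ.+ d) ≡ (a ℚ.- c) ℚ.+ (b ℚ.- d)
    rearrange a b c d = trans
      (cong (a ℚ.+ b ℚ.+_) (ℚ.neg-distrib-+ c d))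
      (interchange a b (ℚ.- c) (ℚ.- d))

  neg-cauchy : ∀ x → Cauchy x → Cauchy (λ n → ℚ.- x n)
  neg-cauchy x cx δ 0<δ with cx δ 0<δ
  ... | N , p = N , λ m n m≥ n≥ →
    subst (ℚ._≤ δ)
      (trans (sym (ℚ.∣-p∣≡∣p∣ (x m ℚ.- x n)))
             (cong ∣_∣ (ℚ.neg-distrib-+ (x m) (ℚ.- x n))))
      (p m n m≥ n≥)

  bounded : ∀ x → Cauchy x →
    ∃[ b ] Positive b × (∃[ N ] ∀ n → N ℕ.≤ n → ∣ x n ∣ ℚ.≤ b)
  bounded x cx with cx 1ℚ (ℚ.positive⁻¹ 1ℚ)
  ... | N , p = 1ℚ ℚ.+ ∣ x N ∣ , ℚ.positive 0<b , N , λ n n≥ → begin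
    ∣ x n ∣
      ≡⟨ cong ∣_∣ (split (x n) (x N)) ⟩
    ∣ (x n ℚ.- x N) ℚ.+ x N ∣
      ≤⟨ ℚ.∣p+q∣≤∣p∣+∣q∣ (x n ℚ.- x N) (x N) ⟩
    ∣ x n ℚ.- x N ∣ ℚ.+ ∣ x N ∣
      ≤⟨ ℚ.+-monoˡ-≤ ∣ x N ∣ (p n N n≥ ℕ.≤-refl) ⟩
    1ℚ ℚ.+ ∣ x N ∣ ∎
    where
    open ℚ.≤-Reasoning
    0<b : 0ℚ ℚ.< 1ℚ ℚ.+ ∣ x N ∣
    0<b = ℚ.+-mono-<-≤ (ℚ.positive⁻¹ 1ℚ) (ℚ.0≤∣p∣ (x N))
    split : ∀ a b → a ≡ (a ℚ.- b) ℚ.+ b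
    split a b = sym (rightDividesˡ b a)

  mul-≤ : ∀ p q {r s} → 0ℚ ℚ.≤ r →
    ∣ p ∣ ℚ.≤ r → ∣ q ∣ ℚ.≤ s → ∣ p ℚ.* q ∣ ℚ.≤ r ℚ.* s
  mul-≤ p q {r} {s} 0≤r p≤r q≤s = begin
    ∣ p ℚ.* q ∣      ≡⟨ ℚ.∣p*q∣≡∣p∣*∣q∣ p q ⟩
    ∣ p ∣ ℚ.* ∣ q ∣  ≤⟨ ℚ.*-monoʳ-≤-nonNeg ∣ q ∣ {{ℚ.∣-∣-nonNeg q}} p≤r ⟩
    r ℚ.* ∣ q ∣      ≤⟨ ℚ.*-monoˡ-≤-nonNeg r {{ℚ.nonNegative 0≤r}} q≤s ⟩
    r ℚ.* s          ∎
    where open ℚ.≤-Reasoning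

  inverse : ∀ c → Positive c → ∃[ r ] 0ℚ ℚ.< r × c ℚ.* r ≡ 1ℚ
  inverse c c>0 =
    let instance
          c>0′ : Positive c
          c>0′ = c>0
          c≢0 : ℚ.NonZero c
          c≢0 = ℚ.pos⇒nonZero c
    in ℚ.1/ c , ℚ.positive⁻¹ (ℚ.1/ c) {{ℚ.1/pos⇒pos c}} , ℚ.*-inverseʳ c

  tolerance : ∀ a b → Positive a → Positive b → ∀ δ → 0ℚ ℚ.< δ →
    ∃[ η ] 0ℚ ℚ.< η × a ℚ.* η ℚ.+ η ℚ.* b ≡ δ
  tolerance a b a>0 b>0 δ 0<δ
    with inverse (a ℚ.+ b) (ℚ.pos+pos⇒pos a {{a>0}} b {{b>0}})
  ... | r , 0<r , cr≡1 = r ℚ.* δ , 0<rδ , total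
    where
    open ≡-Reasoning
    0<rδ : 0ℚ ℚ.< r ℚ.* δ
    0<rδ = subst (ℚ._< r ℚ.* δ) (ℚ.*-zeroʳ r)
             (ℚ.*-monoʳ-<-pos r {{ℚ.positive 0<r}} 0<δ)
    total : a ℚ.* (r ℚ.* δ) ℚ.+ (r ℚ.* δ) ℚ.* b ≡ δ
    total = begin
      a ℚ.* (r ℚ.* δ) ℚ.+ (r ℚ.* δ) ℚ.* b
        ≡⟨ cong (a ℚ.* (r ℚ.* δ) ℚ.+_) (ℚ.*-comm (r ℚ.* δ) b) ⟩
      a ℚ.* (r ℚ.* δ) ℚ.+ b ℚ.* (r ℚ.* δ)
        ≡⟨ ℚ.*-distribʳ-+ (r ℚ.* δ) a b ⟨
      (a ℚ.+ b) ℚ.* (r ℚ.* δ)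
        ≡⟨ ℚ.*-assoc (a ℚ.+ b) r δ ⟨
      (a ℚ.+ b) ℚ.* r ℚ.* δ
        ≡⟨ cong (ℚ._* δ) cr≡1 ⟩
      1ℚ ℚ.* δ
        ≡⟨ ℚ.*-identityˡ δ ⟩
      δ ∎

  *-telescope : ∀ s t u v →
    s ℚ.* t ℚ.- u ℚ.* v ≡ s ℚ.* (t ℚ.- v) ℚ.+ (s ℚ.- u) ℚ.* v
  *-telescope s t u v = sym (begin
    s ℚ.* (t ℚ.- v) ℚ.+ (s ℚ.- u) ℚ.* v
      ≡⟨ cong₂ ℚ._+_ (x[y-z]≈xy-xz s t v) ([y-z]x≈yx-zx v s u) ⟩
    (s ℚ.* t ℚ.- s ℚ.* v) ℚ.+ (s ℚ.* v ℚ.- u ℚ.* v)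
      ≡⟨ ℚ.+-assoc (s ℚ.* t ℚ.- s ℚ.* v) (s ℚ.* v) (ℚ.- (u ℚ.* v)) ⟨
    (s ℚ.* t ℚ.- s ℚ.* v) ℚ.+ s ℚ.* v ℚ.- u ℚ.* v
      ≡⟨ cong (ℚ._- u ℚ.* v) (rightDividesˡ (s ℚ.* v) (s ℚ.* t)) ⟩
    s ℚ.* t ℚ.- u ℚ.* v ∎)
    where open ≡-Reasoning

  *-diff-≤ : ∀ s t u v {a b η} → 0ℚ ℚ.≤ a → 0ℚ ℚ.≤ η →
    ∣ s ∣ ℚ.≤ a → ∣ t ℚ.- v ∣ ℚ.≤ η → ∣ s ℚ.- u ∣ ℚ.≤ η → ∣ v ∣ ℚ.≤ b →
    ∣ s ℚ.* t ℚ.- u ℚ.* v ∣ ℚ.≤ a ℚ.* η ℚ.+ η ℚ.* b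
  *-diff-≤ s t u v {a} {b} {η} 0≤a 0≤η s≤a t-v≤η s-u≤η v≤b =
    subst (λ r → ∣ r ∣ ℚ.≤ a ℚ.* η ℚ.+ η ℚ.* b) (sym (*-telescope s t u v))
      (ℚ.≤-trans
        {∣ s ℚ.* (t ℚ.- v) ℚ.+ (s ℚ.- u) ℚ.* v ∣}
        {∣ s ℚ.* (t ℚ.- v) ∣ ℚ.+ ∣ (s ℚ.- u) ℚ.* v ∣}
        {a ℚ.* η ℚ.+ η ℚ.* b}
        (ℚ.∣p+q∣≤∣p∣+∣q∣ (s ℚ.* (t ℚ.- v)) ((s ℚ.- u) ℚ.* v))
        (ℚ.+-mono-≤
          {∣ s ℚ.* (t ℚ.- v) ∣} {a ℚ.* η} {∣ (s ℚ.- u) ℚ.* v ∣} {η ℚ.* b}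
          (mul-≤ s (t ℚ.- v) {a} {η} 0≤a s≤a t-v≤η)
          (mul-≤ (s ℚ.- u) v {η} {b} 0≤η s-u≤η v≤b)))

  -- Destructuring by let: with-abstraction would normalise the goal, which is
  -- prohibitively slow for products of rationals.
  *-cauchy : ∀ x y → Cauchy x → Cauchy y → Cauchy (λ n → x n ℚ.* y n)
  *-cauchy x y cx cy δ 0<δ =
    let a , a>0 , K , ∣x∣≤a = bounded x cx
        b , b>0 , L , ∣y∣≤b = bounded y cy
        η , 0<η , total     = tolerance a b a>0 b>0 δ 0<δ
        M , p               = cx η 0<η
        N , q               = cy η 0<η
        KL = K ℕ.⊔ L
        MN = M ℕ.⊔ N
    in KL ℕ.⊔ MN , λ m n m≥ n≥ →
      subst (∣ x m ℚ.* y m ℚ.- x n ℚ.* y n ∣ ℚ.≤_) total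
        (*-diff-≤ (x m) (y m) (x n) (y n) {a} {b} {η}
          (ℚ.<⇒≤ (ℚ.positive⁻¹ a {{a>0}})) (ℚ.<⇒≤ 0<η)
          (∣x∣≤a m (ℕ.m⊔n≤o⇒m≤o K L (ℕ.m⊔n≤o⇒m≤o KL MN m≥)))
          (q m n (ℕ.m⊔n≤o⇒n≤o M N (ℕ.m⊔n≤o⇒n≤o KL MN m≥))
                 (ℕ.m⊔n≤o⇒n≤o M N (ℕ.m⊔n≤o⇒n≤o KL MN n≥)))
          (p m n (ℕ.m⊔n≤o⇒m≤o M N (ℕ.m⊔n≤o⇒n≤o KL MN m≥))
                 (ℕ.m⊔n≤o⇒m≤o M N (ℕ.m⊔n≤o⇒n≤o KL MN n≥)))
          (∣y∣≤b n (ℕ.m⊔n≤o⇒n≤o K L (ℕ.m⊔n≤o⇒m≤o KL MN n≥))))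

fromℚ : ℚ → ℝ
fromℚ q = mkℝ (λ _ → q) (const-cauchy q)

0ℝ 1ℝ : ℝ
0ℝ = fromℚ 0ℚ
1ℝ = fromℚ 1ℚ

_+ℝ_ _-ℝ_ _*ℝ_ : ℝ → ℝ → ℝ
x +ℝ y = mkℝ (λ n → seq x n ℚ.+ seq y n)
             (+-cauchy (seq x) (seq y) (cauchy x) (cauchy y))
x -ℝ y = mkℝ (λ n → seq x n ℚ.- seq y n)
             (+-cauchy (seq x) (λ n → ℚ.- seq y n)
               (cauchy x) (neg-cauchy (seq y) (cauchy y)))
x *ℝ y = mkℝ (λ n → seq x n ℚ.* seq y n)
             (*-cauchy (seq x) (seq y) (cauchy x) (cauchy y))

------------------------------------------------------------------------
-- Binary predicates

BinPred : Set → Set → Set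
BinPred X Y = X → Y → Bool

Singleton : ∀ {X Y} → BinPred X Y → Set
Singleton {X} {Y} P = ∃! {A = X × Y} _≡_ λ (x , y) → P x y ≡ true

⟨_⟩ : ∀ {d} → Subset d → Set
⟨ B ⟩ = ∃ (_∈ B)

restrict : ∀ {d} → BinPred (Fin d) (Fin d) →
           (B C : Subset d) → BinPred ⟨ B ⟩ ⟨ C ⟩
restrict P B C b c = P (proj₁ b) (proj₁ c)

------------------------------------------------------------------------
-- Binary CSP instances with variables Fin k and domain Fin d

record Constraint (k d : ℕ) : Set where
  field
    u v  : Fin k
    u≢v  : u ≢ v
    pred : BinPred (Fin d) (Fin d)

open Constraint public

-- Equality of constraints as pairs ⟨(u,v),P⟩; predicates are extensional.
infix 4 _≈_
_≈_ : ∀ {k d} → Constraint k d → Constraint k d → Set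
π ≈ ρ = u π ≡ u ρ × v π ≡ v ρ × (∀ a b → pred π a b ≡ pred ρ a b)

-- The finite set Π is an enumeration without repetitions, so that a weight
-- function on Π is a family indexed by Fin ∣Π∣.
record Instance (k d : ℕ) : Set where
  field
    ∣Π∣      : ℕ
    Π        : Fin ∣Π∣ → Constraint k d
    distinct : Injective _≡_ _≈_ Π
    w        : Fin ∣Π∣ → ℝ
    w>0      : ∀ i → 0ℝ <ℝ w i

open Instance public

CSP : ∀ {k d} → BinPred (Fin d) (Fin d) → Instance k d → Set
CSP P I = ∀ i a b → pred (Π I i) a b ≡ P a b

boolToℝ : Bool → ℝ
boolToℝ true  = 1ℝ
boolToℝ false = 0ℝ

Val : ∀ {k d} → Instance k d → (Fin k → Fin d) → ℝ
Val I A = foldr _+ℝ_ 0ℝ λ i →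
  w I i *ℝ boolToℝ (pred (Π I i) (A (u (Π I i))) (A (v (Π I i))))

_⊆Π_ : ∀ {k d} → Instance k d → Instance k d → Set
J ⊆Π I = ∀ j → ∃[ i ] Π J j ≈ Π I i

record IsSparsifier {k d} (ε : ℝ) (I J : Instance k d) : Set where
  field
    subset : J ⊆Π I
    lower  : ∀ A → (1ℝ -ℝ ε) *ℝ Val I A ≤ℝ Val J A
    upper  : ∀ A → Val J A ≤ℝ (1ℝ +ℝ ε) *ℝ Val I A

{-# OPTIONS --safe #-}
module Submission where

-- Take all n² constraints between n left and n right variables, with unit
-- weights.  If (b , c) is the only satisfying tuple of {b , b′} × {c , c′}, the
-- assignment giving b to xᵢ and b′ to the other left variables, c to yⱼ and c′
-- to the other right variables satisfies the constraint on (xᵢ , yⱼ) and no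
-- other.  A sub-instance omitting it has value 0 there, against at least
-- 1 - ε > 0, so every sparsifier contains every constraint.

open import Defs
open import Data.Bool.Base using (Bool; true; false; if_then_else_)
import Data.Bool.Properties as Bool
open import Data.Fin.Base using (Fin; zero; suc; combine; remQuot; quotient; remainder)
open import Data.Fin.Properties using (_≟_; any?; injective⇒≤; combine-injectiveʳ;
  combine-injectiveˡ; combine-remQuot; remQuot-combine)
open import Data.Fin.Subset using (Subset; ∣_∣; ⁅_⁆; _∈_; _⊆_)
open import Data.Fin.Subset.Properties using (_∈?_; p⊆q⇒∣p∣≤∣q∣; ∣⁅x⁆∣≡1; x∈⁅x⁆)
open import Data.Nat.Base using (ℕ; NonZero; _*_; _^_; s≤s)
import Data.Nat.Base as ℕ
import Data.Nat.Properties as ℕ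
open import Data.Product.Base using (Σ-syntax; ∃-syntax; _×_; _,_; proj₁; proj₂)
open import Data.Rational.Base as ℚ using (ℚ; 0ℚ; 1ℚ)
import Data.Rational.Properties as ℚ
open import Data.Vec.Functional using (foldr)
open import Function.Base using (_∘_)
open import Function.Definitions using (Injective)
open import Relation.Binary.PropositionalEquality
  using (_≡_; _≢_; refl; sym; trans; cong; cong₂; subst)
open import Relation.Nullary using (¬_; yes; no; does)
open import Relation.Nullary.Decidable using (_×-dec_; ¬?; decidable-stable)
open import Relation.Nullary.Negation using (contradiction)

-- Isolated tuples from singleton restrictions

-- Otherwise `B` would lie inside `⁅ b ⁆` and have at most one element.
other-element : ∀ {d} (B : Subset d) {b} → ∣ B ∣ ≡ 2 →
  ∃[ b′ ] b′ ∈ B × b′ ≢ b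
other-element B {b} ∣B∣≡2 with any? (λ x → (x ∈? B) ×-dec ¬? (x ≟ b))
... | yes found = found
... | no none = contradiction 2≤1 λ { (s≤s ()) }
  where
  B⊆⁅b⁆ : B ⊆ ⁅ b ⁆
  B⊆⁅b⁆ {x} x∈B = subst (_∈ ⁅ b ⁆)
    (sym (decidable-stable (x ≟ b) λ x≢b → none (x , x∈B , x≢b))) (x∈⁅x⁆ b)
  2≤1 : 2 ℕ.≤ 1
  2≤1 = begin
    2          ≡⟨ ∣B∣≡2 ⟨
    ∣ B ∣      ≤⟨ p⊆q⇒∣p∣≤∣q∣ B⊆⁅b⁆ ⟩
    ∣ ⁅ b ⁆ ∣  ≡⟨ ∣⁅x⁆∣≡1 b ⟩
    1          ∎
    where open ℕ.≤-Reasoning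

record IsolatedTuple {d} (P : BinPred (Fin d) (Fin d)) : Set where
  field
    b b′ c c′ : Fin d
    P-b-c     : P b c ≡ true
    P-b′-c    : P b′ c ≢ true
    P-b-c′    : P b c′ ≢ true
    P-b′-c′   : P b′ c′ ≢ true

isolatedTuple : ∀ {d} (P : BinPred (Fin d) (Fin d)) (B C : Subset d) →
  ∣ B ∣ ≡ 2 → ∣ C ∣ ≡ 2 → Singleton (restrict P B C) → IsolatedTuple P
isolatedTuple P B C ∣B∣≡2 ∣C∣≡2 (((b , b∈B) , (c , c∈C)) , Pbc , unique)
  with other-element B {b} ∣B∣≡2 | other-element C {c} ∣C∣≡2
... | b′ , b′∈B , b′≢b | c′ , c′∈C , c′≢c = record
  { b = b ; b′ = b′ ; c = c ; c′ = c′
  ; P-b-c   = Pbc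
  ; P-b′-c  = λ t → b′≢b (sym (proj₁ (only b′∈B c∈C t)))
  ; P-b-c′  = λ t → c′≢c (sym (proj₂ (only b∈B c′∈C t)))
  ; P-b′-c′ = λ t → b′≢b (sym (proj₁ (only b′∈B c′∈C t)))
  }
  where
  -- Uniqueness speaks of elements paired with membership proofs; matching on `refl` leaves the
  -- equalities of the elements themselves.
  only : ∀ {x y} → x ∈ B → y ∈ C → P x y ≡ true → b ≡ x × c ≡ y
  only x∈B y∈C t with unique {(_ , x∈B) , (_ , y∈C)} t
  ... | refl = refl , refl

-- Finite sums and values, index by index

Σℝ : ∀ {m} → (Fin m → ℝ) → ℝ
Σℝ = foldr _+ℝ_ 0ℝ

-- The index `k` of the Cauchy sequences is fixed, so that this and the next two bounds are
-- statements about rational sums.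
Σℝ-zero : ∀ {m} (t : Fin m → ℝ) k →
  (∀ i → seq (t i) k ≡ 0ℚ) → seq (Σℝ t) k ≡ 0ℚ
Σℝ-zero {ℕ.zero}  t k t≡0 = refl
Σℝ-zero {ℕ.suc m} t k t≡0 =
  cong₂ ℚ._+_ (t≡0 zero) (Σℝ-zero (t ∘ suc) k (t≡0 ∘ suc))

Σℝ-nonneg : ∀ {m} (t : Fin m → ℝ) k →
  (∀ i → 0ℚ ℚ.≤ seq (t i) k) → 0ℚ ℚ.≤ seq (Σℝ t) k
Σℝ-nonneg {ℕ.zero}  t k 0≤t = ℚ.≤-refl
Σℝ-nonneg {ℕ.suc m} t k 0≤t =
  ℚ.+-mono-≤ (0≤t zero) (Σℝ-nonneg (t ∘ suc) k (0≤t ∘ suc))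

term≤Σℝ : ∀ {m} (t : Fin m → ℝ) k →
  (∀ i → 0ℚ ℚ.≤ seq (t i) k) → ∀ i → seq (t i) k ℚ.≤ seq (Σℝ t) k
term≤Σℝ t k 0≤t zero =
  subst (ℚ._≤ seq (Σℝ t) k) (ℚ.+-identityʳ (seq (t zero) k))
    (ℚ.+-monoʳ-≤ (seq (t zero) k) (Σℝ-nonneg (t ∘ suc) k (0≤t ∘ suc)))
term≤Σℝ t k 0≤t (suc i) =
  subst (ℚ._≤ seq (Σℝ t) k) (ℚ.+-identityˡ (seq (t (suc i)) k))
    (ℚ.+-mono-≤ (0≤t zero) (term≤Σℝ (t ∘ suc) k (0≤t ∘ suc) i))

sat : ∀ {k d} → (Fin k → Fin d) → Constraint k d → Bool
sat A π = pred π (A (u π)) (A (v π))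

sat-≈ : ∀ {k d} (A : Fin k → Fin d) (π ρ : Constraint k d) →
  π ≈ ρ → sat A π ≡ sat A ρ
sat-≈ A π ρ (u≡ , v≡ , pred≡) =
  trans (pred≡ _ _) (cong₂ (λ x y → pred ρ (A x) (A y)) u≡ v≡)

Val-unsat : ∀ {k d} (I : Instance k d) (A : Fin k → Fin d) →
  (∀ i → sat A (Π I i) ≢ true) → ∀ m → seq (Val I A) m ≡ 0ℚ
Val-unsat I A unsat m = Σℝ-zero (λ i → w I i *ℝ boolToℝ (sat A (Π I i))) m λ i →
  trans (cong (λ t → seq (w I i) m ℚ.* seq (boolToℝ t) m) (Bool.¬-not (unsat i)))
        (ℚ.*-zeroʳ (seq (w I i) m))

0≤1 : 0ℚ ℚ.≤ 1ℚ
0≤1 = ℚ.nonNegative⁻¹ 1ℚ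

-- The satisfied constraint contributes 1 and the others at least 0. Unit weights make this hold at
-- every index `m`; the sequence of a merely positive real may start with negative terms.
Val-sat : ∀ {k d} (I : Instance k d) → (∀ i → w I i ≡ 1ℝ) → (A : Fin k → Fin d) →
  ∀ i → sat A (Π I i) ≡ true → ∀ m → 1ℚ ℚ.≤ seq (Val I A) m
Val-sat I w≡1 A i satᵢ m =
  subst (ℚ._≤ seq (Val I A) m) (trans (eval i) (cong value satᵢ))
    (term≤Σℝ term m (λ j → subst (0ℚ ℚ.≤_) (sym (eval j)) (value≥0 (sat A (Π I j)))) i)
  where
  term : Fin (∣Π∣ I) → ℝ
  term j = w I j *ℝ boolToℝ (sat A (Π I j))
  value : Bool → ℚ
  value t = seq (boolToℝ t) m
  value≥0 : ∀ t → 0ℚ ℚ.≤ value t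
  value≥0 true  = 0≤1
  value≥0 false = ℚ.≤-refl
  eval : ∀ j → seq (term j) m ≡ value (sat A (Π I j))
  eval j = trans (cong (λ r → seq r m ℚ.* value (sat A (Π I j))) (w≡1 j))
                 (ℚ.*-identityˡ _)

-- The gap `δ` and threshold `N` that witness `ε <ℝ 1ℝ` also witness `y <ℝ (1ℝ -ℝ ε) *ℝ x`: from `N`
-- on, `1 - ε` is at least `δ`, and `x` is at least 1.
scaled-≰0 : ∀ ε x y → ε <ℝ 1ℝ →
  (∀ m → 1ℚ ℚ.≤ seq x m) → (∀ m → seq y m ≡ 0ℚ) →
  ¬ ((1ℝ -ℝ ε) *ℝ x ≤ℝ y)
scaled-≰0 ε x y (δ , 0<δ , N , ε+δ≤1) 1≤x y≡0 ≤y = ≤y (δ , 0<δ , N , below)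
  where
  open ℚ.≤-Reasoning
  below : ∀ m → N ℕ.≤ m → seq y m ℚ.+ δ ℚ.≤ (1ℚ ℚ.- seq ε m) ℚ.* seq x m
  below m m≥N = begin
    seq y m ℚ.+ δ       ≡⟨ cong (ℚ._+ δ) (y≡0 m) ⟩
    0ℚ ℚ.+ δ            ≡⟨ ℚ.+-identityˡ δ ⟩
    δ                   ≡⟨ ℚ.*-identityʳ δ ⟨
    δ ℚ.* 1ℚ            ≤⟨ ℚ.*-monoˡ-≤-nonNeg δ {{ℚ.nonNegative (ℚ.<⇒≤ 0<δ)}} (1≤x m) ⟩
    δ ℚ.* seq x m       ≤⟨ ℚ.*-monoʳ-≤-nonNeg (seq x m)
                             {{ℚ.nonNegative (ℚ.≤-trans 0≤1 (1≤x m))}} δ≤1-ε ⟩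
    (1ℚ ℚ.- seq ε m) ℚ.* seq x m ∎
    where
    δ≤1-ε : δ ℚ.≤ 1ℚ ℚ.- seq ε m
    δ≤1-ε = begin
      δ                              ≡⟨ ℚ.+-identityʳ δ ⟨
      δ ℚ.+ 0ℚ                       ≡⟨ cong (δ ℚ.+_) (ℚ.+-inverseʳ (seq ε m)) ⟨
      δ ℚ.+ (seq ε m ℚ.- seq ε m)    ≡⟨ ℚ.+-assoc δ (seq ε m) (ℚ.- seq ε m) ⟨
      δ ℚ.+ seq ε m ℚ.- seq ε m      ≡⟨ cong (ℚ._- seq ε m) (ℚ.+-comm δ (seq ε m)) ⟩
      seq ε m ℚ.+ δ ℚ.- seq ε m      ≤⟨ ℚ.+-monoˡ-≤ (ℚ.- seq ε m) (ε+δ≤1 m m≥N) ⟩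
      1ℚ ℚ.- seq ε m                 ∎

-- Sparsifiers keep every constraint

-- Injections between the index sets in both directions: the inclusion `f` of the constraints of
-- `J`, and a right inverse `g` of `f`.
sparsifier-size : ∀ {k d} (I : Instance k d) → (∀ i → w I i ≡ 1ℝ) →
  (A : Fin (∣Π∣ I) → Fin k → Fin d) →
  (∀ i → sat (A i) (Π I i) ≡ true) →
  (∀ i j → sat (A i) (Π I j) ≡ true → j ≡ i) →
  ∀ ε → ε <ℝ 1ℝ → ∀ J → IsSparsifier ε I J → ∣Π∣ J ≡ ∣Π∣ I
sparsifier-size I w≡1 A sat-self sat-only ε ε<1 J J-sparsifies =
  ℕ.≤-antisym (injective⇒≤ f-injective) (injective⇒≤ g-injective)
  where
  open IsSparsifier J-sparsifies
  f : Fin (∣Π∣ J) → Fin (∣Π∣ I)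
  f j = proj₁ (subset j)
  f-injective : Injective _≡_ _≡_ f
  f-injective {j} {j′} fj≡fj′ = distinct J (≈-via (Π J j) (Π J j′) (subset j) (subset j′) fj≡fj′)
    where
    -- Both constraints agree with the same constraint of `I`. The witnesses are generalised to `p`
    -- and `q` so that the equality of their indices can be matched with `refl`.
    ≈-via : ∀ π ρ (p : ∃[ i ] π ≈ Π I i) (q : ∃[ i ] ρ ≈ Π I i) →
            proj₁ p ≡ proj₁ q → π ≈ ρ
    ≈-via _ _ (_ , u₁ , v₁ , p₁) (_ , u₂ , v₂ , p₂) refl =
      trans u₁ (sym u₂) , trans v₁ (sym v₂) , λ a b → trans (p₁ a b) (sym (p₂ a b))
  covered : ∀ i → ∃[ j ] f j ≡ i
  -- The search over a finite index set is decidable, so refuting `missed` suffices. A constraint of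
  -- `J` satisfied by `A i` would have index `i` in `I` by `sat-only`; hence `Val J (A i)` is 0,
  -- against the lower bound.
  covered i = decidable-stable (any? λ j → f j ≟ i) λ missed →
    scaled-≰0 ε (Val I (A i)) (Val J (A i)) ε<1
      (Val-sat I w≡1 (A i) i (sat-self i))
      (Val-unsat J (A i) λ j t → missed
        (j , sat-only i (f j)
          (trans (sym (sat-≈ (A i) (Π J j) (Π I (f j)) (proj₂ (subset j)))) t)))
      (lower (A i))
  g : Fin (∣Π∣ I) → Fin (∣Π∣ J)
  g i = proj₁ (covered i)
  g-injective : Injective _≡_ _≡_ g
  g-injective {i} {i′} gi≡gi′ =
    trans (sym (proj₂ (covered i))) (trans (cong f gi≡gi′) (proj₂ (covered i′)))

-- The complete bipartite instance and its isolating assignments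

module CompleteBipartite {d} (P : BinPred (Fin d) (Fin d)) (n : ℕ) where

  -- Variables are coded as pairs in `Fin 2 × Fin n`, the first component being the side;
  -- constraints are coded as pairs (row, column) in `Fin n × Fin n`.
  left right : Fin n → Fin (2 * n)
  left  = combine {2} zero
  right = combine {2} (suc zero)

  left≢right : ∀ i j → left i ≢ right j
  left≢right i j eq with combine-injectiveˡ {2} zero i (suc zero) j eq
  ... | ()

  row column : Fin (n * n) → Fin n
  row    = quotient {n} n
  column = remainder {n} n

  row-column-injective : ∀ {k l} → row k ≡ row l → column k ≡ column l → k ≡ l
  row-column-injective {k} {l} rows≡ columns≡ =
    trans (sym (combine-remQuot {n} n k))
      (trans (cong₂ combine rows≡ columns≡) (combine-remQuot {n} n l))

  instance′ : Instance (2 * n) d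
  instance′ = record
    { ∣Π∣ = n * n
    ; Π = λ k → record
      { u = left (row k) ; v = right (column k)
      ; u≢v = left≢right (row k) (column k) ; pred = P }
    ; distinct = λ {k} {l} (u≡ , v≡ , _) → row-column-injective
        (combine-injectiveʳ {2} zero (row k) zero (row l) u≡)
        (combine-injectiveʳ {2} (suc zero) (column k) (suc zero) (column l) v≡)
    ; w = λ _ → 1ℝ
    ; w>0 = λ _ → 1ℚ , ℚ.positive⁻¹ 1ℚ , 0 , λ _ _ → ℚ.≤-refl
    }

  module _ (T : IsolatedTuple P) where
    open IsolatedTuple T

    choose : ∀ {X : Set} → Fin n → X → X → Fin n → X
    choose i x y j = if does (j ≟ i) then x else y

    value : Fin (n * n) → Fin 2 × Fin n → Fin d
    value k (zero     , i) = choose (row k) b b′ i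
    value k (suc zero , j) = choose (column k) c c′ j

    assignment : Fin (n * n) → Fin (2 * n) → Fin d
    assignment k x = value k (remQuot n x)

    assignment-left : ∀ k i → assignment k (left i) ≡ choose (row k) b b′ i
    assignment-left k i = cong (value k) (remQuot-combine {2} zero i)

    assignment-right : ∀ k j → assignment k (right j) ≡ choose (column k) c c′ j
    assignment-right k j = cong (value k) (remQuot-combine {2} (suc zero) j)

    sat-choose : ∀ k l → sat (assignment k) (Π instance′ l) ≡
      P (choose (row k) b b′ (row l)) (choose (column k) c c′ (column l))
    sat-choose k l =
      cong₂ P (assignment-left k (row l)) (assignment-right k (column l))

    choose-self : ∀ i {x y : Fin d} → choose i x y i ≡ x
    choose-self i with i ≟ i
    ... | yes _  = refl
    ... | no i≢i = contradiction refl i≢i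

    sat-self : ∀ k → sat (assignment k) (Π instance′ k) ≡ true
    sat-self k = trans (sat-choose k k)
      (trans (cong₂ P (choose-self (row k)) (choose-self (column k))) P-b-c)

    -- A wrong row or column puts `b′` or `c′` into the tuple, and each of the three resulting
    -- tuples violates `P`.
    P-choose : ∀ i j i′ j′ →
      P (choose i b b′ i′) (choose j c c′ j′) ≡ true → i′ ≡ i × j′ ≡ j
    P-choose i j i′ j′ t with i′ ≟ i | j′ ≟ j
    ... | yes i≡ | yes j≡ = i≡ , j≡
    ... | yes _  | no _   = contradiction t P-b-c′
    ... | no _   | yes _  = contradiction t P-b′-c
    ... | no _   | no _   = contradiction t P-b′-c′

    sat-only : ∀ k l → sat (assignment k) (Π instance′ l) ≡ true → l ≡ k
    sat-only k l t =
      let rows≡ , columns≡ = P-choose (row k) (column k) (row l) (column l)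
                               (trans (sym (sat-choose k l)) t)
      in row-column-injective rows≡ columns≡

theorem3 : ∀ (d : ℕ) (P : BinPred (Fin d) (Fin d)) →
    (Σ[ B ∈ Subset d ] Σ[ C ∈ Subset d ]
    (∣ B ∣ ≡ 2 × ∣ C ∣ ≡ 2 × Singleton (restrict P B C))) →
    ∀ (n : ℕ) → .{{_ : NonZero n}} →
    Σ[ I ∈ Instance (2 * n) d ]
    (CSP P I × ∣Π∣ I ≡ n ^ 2 ×
    (∀ (ε : ℝ) → 0ℝ <ℝ ε → ε <ℝ 1ℝ →
    ∀ (J : Instance (2 * n) d) → IsSparsifier ε I J → ∣Π∣ J ≡ n ^ 2))
theorem3 d P (B , C , ∣B∣≡2 , ∣C∣≡2 , singleton) n =
  instance′ , (λ _ _ _ → refl) , size , λ ε _ ε<1 J J-sparsifies →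
    trans (sparsifier-size instance′ (λ _ → refl) (assignment T)
            (sat-self T) (sat-only T) ε ε<1 J J-sparsifies)
          size
  where
  open CompleteBipartite P n
  T : IsolatedTuple P
  T = isolatedTuple P B C ∣B∣≡2 ∣C∣≡2 singleton
  size : n * n ≡ n ^ 2
  -- `n ^ 2` unfolds to `n * (n * 1)`.
  size = cong (n *_) (sym (ℕ.*-identityʳ n))
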